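{- For any set $X$, the center of $\mathcal{M}(X)$ consists only of the left zeros and the right zeros operations, i.e. $Z(\mathcal{M}(X))=\{\circ_{lz},\circ_{rz}\}$.
   Context: $\mathcal{M}(X)=X^{X\times X}$ is the set of all binary operations on $X$, a monoid under $\triangleright$ defined by $a(\circ\triangleright\ast)b=(a\circ b)\ast(b\circ a)$ for all $a,b\in X$. The left zeros operation is $a\circ_{lz}b=a$ and the right zeros operation is $a\circ_{rz}b=b$ for all $a,b\in X$. The center is $Z(\mathcal{M}(X))=\{\ast\in\mathcal{M}(X):\ast\triangleright\circ=\circ\triangleright\ast\text{ for all }\circ\in\mathcal{M}(X)\}$. -}

module Defs where

open import Algebra.Bundles using (Monoid)
open import Algebra.Core using (Op₂)
open import Data.Product.Base using (_,_)
open import Level using (Level; _⊔_)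
open import Relation.Binary.PropositionalEquality
  using (_≡_; refl; sym; trans; cong₂)
open import Relation.Unary using (Pred)

private
  variable
    a c ℓ : Level
    X : Set a

infix  4 _≋_
infixl 7 _▷_

-- Equality of binary operations is pointwise, since function
-- extensionality is not available.
_≋_ : Op₂ X → Op₂ X → Set _
_∘_ ≋ _∗_ = ∀ x y → x ∘ y ≡ x ∗ y

_▷_ : Op₂ X → Op₂ X → Op₂ X
(_∘_ ▷ _∗_) x y = (x ∘ y) ∗ (y ∘ x)

leftZeros : Op₂ X
leftZeros x y = x

rightZeros : Op₂ X
rightZeros x y = y

𝓜 : Set a → Monoid a a
𝓜 X = record
  { Carrier  = Op₂ X
  ; _≈_      = _≋_
  ; _∙_      = _▷_
  ; ε        = leftZeros
  ; isMonoid = record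
    { isSemigroup = record
      { isMagma = record
        { isEquivalence = record
          { refl  = λ x y → refl
          ; sym   = λ p x y → sym (p x y)
          ; trans = λ p q x y → trans (p x y) (q x y)
          }
        ; ∙-cong = λ {_} {_} {_∗_} p q x y →
            trans (cong₂ _∗_ (p x y) (p y x)) (q _ _)
        }
      ; assoc = λ _ _ _ x y → refl
      }
    ; identity = (λ _ x y → refl) , (λ _ x y → refl)
    }
  }

Center : (M : Monoid c ℓ) → Pred (Monoid.Carrier M) (c ⊔ ℓ)
Center M z = ∀ m → z ∙ m ≈ m ∙ z
  where open Monoid M

{-# OPTIONS --safe #-}
-- Let z be central and a ≢ b.  Given p and q, let m send (a , b) to p and every
-- other pair to q.  Comparing z ▷ m with m ▷ z at (a , b) shows that p z q is p
-- if (a z b , b z a) is (a , b), and q otherwise.  This condition does not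
-- depend on p and q, so z is one of the two projections.
module Submission where

open import Defs
open import Axiom.ExcludedMiddle using (ExcludedMiddle)
open import Relation.Unary using (_≐_; _∪_)
open import Algebra.Core using (Op₂)
open import Data.Bool.Base using (if_then_else_)
open import Data.Product.Base using (_×_; _,_; proj₁; ∃₂)
open import Data.Sum.Base using (_⊎_; inj₁; inj₂)
open import Function.Base using (_∘_)
open import Relation.Binary.Definitions using (DecidableEquality)
open import Relation.Binary.PropositionalEquality
  using (_≡_; _≢_; refl; sym; trans; cong; cong₂; module ≡-Reasoning)
open import Relation.Nullary.Decidable
  using (yes; no; does; dec-true; dec-false; decidable-stable)

module _ {ℓ} {X : Set ℓ} where

  leftZeros-central : ∀ {z} → z ≋ leftZeros → Center (𝓜 X) z
  leftZeros-central z≋lz m x y =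
    trans (cong₂ m (z≋lz x y) (z≋lz y x)) (sym (z≋lz (m x y) (m y x)))

  -- Multiplying by `rightZeros` on either side swaps the arguments of `m`: both products send (x ,
  -- y) to `m y x`.
  rightZeros-central : ∀ {z} → z ≋ rightZeros → Center (𝓜 X) z
  rightZeros-central z≋rz m x y =
    trans (cong₂ m (z≋rz x y) (z≋rz y x)) (sym (z≋rz (m x y) (m y x)))

  module _ (_≟_ : DecidableEquality (X × X)) where

    oneExceptionalPair : X × X → X → X → Op₂ X
    oneExceptionalPair ab p q u v = if does ((u , v) ≟ ab) then p else q

    -- As `a ≢ b`, the swapped pair (b , a) is not exceptional, so `m a b` and `m b a` are the
    -- freely chosen p and q, and centrality expresses `z p q` through `m`.
    central-value : ∀ {z a b} → Center (𝓜 X) z → a ≢ b → ∀ p q →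
                    z p q ≡ oneExceptionalPair (a , b) p q (z a b) (z b a)
    central-value {z} {a} {b} central a≢b p q = begin
      z p q              ≡⟨ cong₂ z mab≡p mba≡q ⟨
      z (m a b) (m b a)  ≡⟨ central m a b ⟨
      m (z a b) (z b a)  ∎
      where
      open ≡-Reasoning
      m = oneExceptionalPair (a , b) p q
      mab≡p : m a b ≡ p
      mab≡p = cong (if_then p else q) (dec-true ((a , b) ≟ (a , b)) refl)
      mba≡q : m b a ≡ q
      mba≡q = cong (if_then p else q)
        (dec-false ((b , a) ≟ (a , b)) (a≢b ∘ sym ∘ cong proj₁))

    central⇒zeros : ∀ {z a b} → a ≢ b → Center (𝓜 X) z →
                    z ≋ leftZeros ⊎ z ≋ rightZeros
    central⇒zeros {z} {a} {b} a≢b central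
      -- The test is made before p and q are given, so its outcome reduces the conditional in
      -- `value` for all p and q at once.
      with (z a b , z b a) ≟ (a , b) | central-value {z} central a≢b
    ... | yes _ | value = inj₁ value
    ... | no  _ | value = inj₂ value

proposition27 : ∀ {ℓ} → ExcludedMiddle ℓ → (X : Set ℓ) →
    Center (𝓜 X) ≐ ((_≋ leftZeros) ∪ (_≋ rightZeros))
proposition27 em X = to , from
  where
  to : ∀ {z} → Center (𝓜 X) z → z ≋ leftZeros ⊎ z ≋ rightZeros
  to {z} central with em {∃₂ λ (a b : X) → a ≢ b}
  ... | yes (_ , _ , a≢b) = central⇒zeros (λ _ _ → em) {z} a≢b central
  -- Here X has at most one element, so both projections agree with `z`; the choice of `inj₁` is
  -- arbitrary.
  ... | no  ¬distinct     =
    inj₁ λ x y → decidable-stable em λ ≢x → ¬distinct (z x y , x , ≢x)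

  from : ∀ {z} → z ≋ leftZeros ⊎ z ≋ rightZeros → Center (𝓜 X) z
  from {z} (inj₁ z≋lz) = leftZeros-central {z = z} z≋lz
  from {z} (inj₂ z≋rz) = rightZeros-central {z = z} z≋rz
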